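{- For any twin-free graph $G$ on $n$ vertices, we have $\text{max-sep}_{RB}(G)\leq\mathrm{sep}(G)\leq n-1$.
   Context: All graphs are finite, simple and undirected, with at least one vertex. $N[x]$ denotes the closed neighborhood of $x$. A graph is twin-free if no two distinct vertices have the same closed neighborhood. A red-blue coloring of $G$ is a map $c:V(G)\to\{\text{red},\text{blue}\}$. A red-blue separating set of $(G,c)$ is a set $S\subseteq V(G)$ such that $N[r]\cap S\neq N[b]\cap S$ for every red vertex $r$ and every blue vertex $b$. For $G$ twin-free, $\mathrm{sep}_{RB}(G,c)$ is the smallest size of a red-blue separating set of $(G,c)$, and $\text{max-sep}_{RB}(G)$ is the maximum of $\mathrm{sep}_{RB}(G,c)$ over all red-blue colorings $c$ of $G$. For $G$ twin-free, $\mathrm{sep}(G)$ is the smallest size of a set $S\subseteq V(G)$ such that $N[x]\cap S\neq N[y]\cap S$ for all distinct vertices $x,y$ of $G$. -}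

module Defs where

open import Data.Bool.Base using (if_then_else_)
import Data.Bool.Properties as Bool
open import Data.Fin.Base using (Fin)
import Data.Fin.Properties as Fin
open import Data.Fin.Subset using (Subset; _∩_; ∣_∣; ⊤)
open import Data.Fin.Subset.Properties using (anySubset?; ∩-identityʳ; ∣p∣≤n)
open import Data.Nat.Base using (ℕ; zero; suc; _≤_; z≤n; s≤s; s≤s⁻¹)
open import Data.Nat.Properties using (_≟_; ≤-antisym; ≤∧≢⇒<; n≤0⇒n≡0)
open import Data.Product.Base using (∃; _×_; _,_; proj₁; proj₂)
open import Data.Vec.Base using (lookup; tabulate)
open import Data.Vec.Properties using (≡-dec; lookup∘tabulate)
open import Function.Base using (_∘_)
open import Level using (0ℓ)
open import Relation.Binary.Core using (Rel)
import Relation.Binary.Definitions as B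
open import Relation.Binary.PropositionalEquality
  using (_≡_; _≢_; _≗_; refl; sym; trans; subst; subst₂)
open import Relation.Nullary.Decidable
  using (yes; no; does; map′; ¬?; _×-dec_; _⊎-dec_; _→-dec_)
open import Relation.Nullary.Negation using (contradiction)
open import Relation.Unary using (Pred; Decidable)

record Graph (n : ℕ) : Set₁ where
  field
    Adj    : Rel (Fin n) 0ℓ
    adj?   : B.Decidable Adj
    symm   : B.Symmetric Adj
    irrefl : B.Irreflexive _≡_ Adj

  N[_] : Fin n → Subset n
  N[ x ] = tabulate λ y → does ((x Fin.≟ y) ⊎-dec adj? x y)

module _ {n : ℕ} (G : Graph n) where
  open Graph G

  TwinFree : Set
  TwinFree = ∀ x y → x ≢ y → N[ x ] ≢ N[ y ]

  Separating : Pred (Subset n) 0ℓ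
  Separating S = ∀ x y → x ≢ y → N[ x ] ∩ S ≢ N[ y ] ∩ S

data Color : Set where
  red blue : Color

Coloring : ℕ → Set
Coloring n = Fin n → Color

RedBlueSeparating : ∀ {n} → Graph n → Coloring n → Pred (Subset n) 0ℓ
RedBlueSeparating G c S =
  ∀ r b → c r ≡ red → c b ≡ blue → N[ r ] ∩ S ≢ N[ b ] ∩ S
  where open Graph G

IsLeast : Pred ℕ 0ℓ → Pred ℕ 0ℓ
IsLeast P k = P k × (∀ {j} → P j → k ≤ j)

IsGreatest : Pred ℕ 0ℓ → Pred ℕ 0ℓ
IsGreatest P k = P k × (∀ {j} → P j → j ≤ k)

least : ∀ {P} → Decidable P → ∀ {m} → P m → ∃ (IsLeast P)
least P? {zero} p = zero , p , λ _ → z≤n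
least {P} P? {suc m} p with P? zero
... | yes p₀ = zero , p₀ , λ _ → z≤n
... | no ¬p₀ with least (P? ∘ suc) p
...   | k , pk , min = suc k , pk , λ
  { {zero}  q → contradiction q ¬p₀
  ; {suc j} q → s≤s (min q)
  }

greatest : ∀ {P} → Decidable P → ∃ P → ∀ {b} → (∀ {j} → P j → j ≤ b) →
           ∃ (IsGreatest P)
greatest {P} P? (m , p) {zero} bound =
  zero , subst P (n≤0⇒n≡0 (bound p)) p , bound
greatest {P} P? w {suc b} bound with P? (suc b)
... | yes q = suc b , q , bound
... | no ¬q = greatest P? w λ p →
  s≤s⁻¹ (≤∧≢⇒< (bound p) λ j≡ → ¬q (subst P j≡ p))

SizeOf : ∀ {n} → Pred (Subset n) 0ℓ → Pred ℕ 0ℓ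
SizeOf P k = ∃ λ S → P S × ∣ S ∣ ≡ k

sizeOf? : ∀ {n} {P : Pred (Subset n) 0ℓ} → Decidable P → Decidable (SizeOf P)
sizeOf? P? k = anySubset? λ S → P? S ×-dec (∣ S ∣ ≟ k)

_≟ₛ_ : ∀ {n} → B.DecidableEquality (Subset n)
_≟ₛ_ = ≡-dec Bool._≟_

_≟ᶜ_ : B.DecidableEquality Color
red  ≟ᶜ red  = yes refl
red  ≟ᶜ blue = no λ ()
blue ≟ᶜ red  = no λ ()
blue ≟ᶜ blue = yes refl

module _ {n : ℕ} (G : Graph n) where
  open Graph G

  separating? : Decidable (Separating G)
  separating? S = Fin.all? λ x → Fin.all? λ y →
    ¬? (x Fin.≟ y) →-dec ¬? ((N[ x ] ∩ S) ≟ₛ (N[ y ] ∩ S))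

  redBlueSeparating? : ∀ c → Decidable (RedBlueSeparating G c)
  redBlueSeparating? c S = Fin.all? λ r → Fin.all? λ b →
    (c r ≟ᶜ red) →-dec ((c b ≟ᶜ blue) →-dec
      ¬? ((N[ r ] ∩ S) ≟ₛ (N[ b ] ∩ S)))

  module _ (tf : TwinFree G) where

    ⊤-separating : Separating G ⊤
    ⊤-separating x y x≢y eq = tf x y x≢y
      (subst₂ _≡_ (∩-identityʳ N[ x ]) (∩-identityʳ N[ y ]) eq)

    ⊤-redBlueSeparating : ∀ c → RedBlueSeparating G c ⊤
    ⊤-redBlueSeparating c r b cr cb = ⊤-separating r b r≢b
      where
      r≢b : r ≢ b
      r≢b refl with () ← trans (sym cr) cb

    sep-exists : ∃ (IsLeast (SizeOf (Separating G)))
    sep-exists = least (sizeOf? separating?) (⊤ , ⊤-separating , refl)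

    sep : ℕ
    sep = proj₁ sep-exists

    sepRB-exists : ∀ c → ∃ (IsLeast (SizeOf (RedBlueSeparating G c)))
    sepRB-exists c =
      least (sizeOf? (redBlueSeparating? c)) (⊤ , ⊤-redBlueSeparating c , refl)

    sepRB : Coloring n → ℕ
    sepRB c = proj₁ (sepRB-exists c)

    sepRB≤n : ∀ c → sepRB c ≤ n
    sepRB≤n c with (S , _ , eq) , _ ← proj₂ (sepRB-exists c) =
      subst (_≤ n) eq (∣p∣≤n S)

    sepRB-mono : ∀ {c d} → c ≗ d → sepRB c ≤ sepRB d
    sepRB-mono {c} {d} c≗d with (S , dS , eq) , _ ← proj₂ (sepRB-exists d) =
      proj₂ (proj₂ (sepRB-exists c))
        (S , (λ r b cr cb → dS r b (trans (sym (c≗d r)) cr)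
                                   (trans (sym (c≗d b)) cb)) , eq)

    sepRB-cong : ∀ {c d} → c ≗ d → sepRB c ≡ sepRB d
    sepRB-cong c≗d = ≤-antisym (sepRB-mono c≗d) (sepRB-mono (sym ∘ c≗d))

    -- Colorings are functions, so to search through them each one is
    -- replaced by its set of red vertices.
    fromReds : Subset n → Coloring n
    fromReds R x = if lookup R x then red else blue

    reds : Coloring n → Subset n
    reds c = tabulate λ x → does (c x ≟ᶜ red)

    fromReds∘reds : ∀ c → fromReds (reds c) ≗ c
    fromReds∘reds c x
      rewrite lookup∘tabulate (λ y → does (c y ≟ᶜ red)) x with c x
    ... | red  = refl
    ... | blue = refl

    sepRBValue? : Decidable λ k → ∃ λ c → sepRB c ≡ k
    sepRBValue? k = map′
      (λ (R , eq) → fromReds R , eq)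
      (λ (c , eq) → reds c , trans (sepRB-cong (fromReds∘reds c)) eq)
      (anySubset? λ R → sepRB (fromReds R) ≟ k)

    max-sepRB-exists : ∃ (IsGreatest λ k → ∃ λ c → sepRB c ≡ k)
    max-sepRB-exists = greatest sepRBValue? (_ , (λ _ → red) , refl)
      λ { (c , refl) → sepRB≤n c }

    max-sepRB : ℕ
    max-sepRB = proj₁ max-sepRB-exists

{-# OPTIONS --safe #-}
-- The second inequality is Bondy's theorem: m + 1 distinct subsets of a finite
-- set stay distinct when intersected with a suitable set S of at most m
-- elements. Induct on the number of subsets: if S separates all but the first
-- one, then at most one other subset can agree with the first on S, and adding
-- to S a point at which these two differ separates everything.
module Submission where

open import Defs
import Data.Bool.Properties as Bool
open import Data.Fin.Base using (Fin; zero; suc)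
import Data.Fin.Properties as Fin
open import Data.Fin.Subset
  using (Subset; inside; outside; _∩_; _∪_; ∣_∣; ⊥; ⁅_⁆)
open import Data.Fin.Subset.Properties
  using (∩-assoc; ∩-comm; ∩-abs-∪; ∪-comm; ∪-identityʳ; ∣⊥∣≡0)
open import Data.Nat.Base using (ℕ; zero; suc; NonZero; _≤_; _∸_; s≤s)
open import Data.Nat.Properties
  using (≤-refl; ≤-reflexive; ≤-trans; m≤n⇒m≤1+n)
open import Data.Product.Base using (∃; _×_; _,_; proj₁; proj₂)
open import Data.Vec.Base using ([]; _∷_)
open import Data.Vec.Properties using (∷-injectiveˡ; ∷-injectiveʳ)
open import Function.Base using (_∘_)
open import Relation.Binary.PropositionalEquality
open import Relation.Nullary.Decidable using (yes; no)
open import Relation.Nullary.Negation using (contradiction)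

∣p∪⁅x⁆∣≤1+∣p∣ : ∀ {n} (p : Subset n) x → ∣ p ∪ ⁅ x ⁆ ∣ ≤ suc ∣ p ∣
∣p∪⁅x⁆∣≤1+∣p∣ (inside  ∷ p) zero rewrite ∪-identityʳ p = m≤n⇒m≤1+n ≤-refl
∣p∪⁅x⁆∣≤1+∣p∣ (outside ∷ p) zero rewrite ∪-identityʳ p = ≤-refl
∣p∪⁅x⁆∣≤1+∣p∣ (inside  ∷ p) (suc x) = s≤s (∣p∪⁅x⁆∣≤1+∣p∣ p x)
∣p∪⁅x⁆∣≤1+∣p∣ (outside ∷ p) (suc x) = ∣p∪⁅x⁆∣≤1+∣p∣ p x

-- Found at the first coordinate where the two vectors differ. A differing point is phrased through
-- `⁅ x ⁆` so that it fits the trace on `S ∪ ⁅ x ⁆`.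
≢⇒∃-∩⁅x⁆-≢ : ∀ {n} {p q : Subset n} → p ≢ q →
              ∃ λ x → p ∩ ⁅ x ⁆ ≢ q ∩ ⁅ x ⁆
≢⇒∃-∩⁅x⁆-≢ {p = []} {[]} p≢q = contradiction refl p≢q
≢⇒∃-∩⁅x⁆-≢ {p = s ∷ p} {t ∷ q} p≢q with s Bool.≟ t
... | no s≢t = zero , λ eq → s≢t
  (subst₂ _≡_ (Bool.∧-identityʳ s) (Bool.∧-identityʳ t) (∷-injectiveˡ eq))
... | yes refl with x , p≢q∩x ← ≢⇒∃-∩⁅x⁆-≢ (p≢q ∘ cong (s ∷_)) =
  suc x , p≢q∩x ∘ ∷-injectiveʳ

-- Intersect both sides with `r` once more and absorb. Read contrapositively, enlarging a set keeps
-- apart everything that it already separates.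
∩∪-≡⇒∩ˡ-≡ : ∀ {n} {p q : Subset n} r s →
            p ∩ (r ∪ s) ≡ q ∩ (r ∪ s) → p ∩ r ≡ q ∩ r
∩∪-≡⇒∩ˡ-≡ {p = p} {q} r s eq =
  trans (sym (absorb p)) (trans (cong (_∩ r) eq) (absorb q))
  where
  absorb : ∀ t → (t ∩ (r ∪ s)) ∩ r ≡ t ∩ r
  absorb t = trans (∩-assoc t (r ∪ s) r)
    (cong (t ∩_) (trans (∩-comm (r ∪ s) r) (∩-abs-∪ r s)))

∩∪-≡⇒∩ʳ-≡ : ∀ {n} {p q : Subset n} r s →
            p ∩ (r ∪ s) ≡ q ∩ (r ∪ s) → p ∩ s ≡ q ∩ s
∩∪-≡⇒∩ʳ-≡ {p = p} {q} r s eq =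
  ∩∪-≡⇒∩ˡ-≡ s r (subst (λ t → p ∩ t ≡ q ∩ t) (∪-comm r s) eq)

Separates : ∀ {m n} → Subset n → (Fin m → Subset n) → Set
Separates S f = ∀ i j → i ≢ j → f i ∩ S ≢ f j ∩ S

separates-cons : ∀ {m n} {S : Subset n} {f : Fin (suc m) → Subset n} →
                 (∀ j → f zero ∩ S ≢ f (suc j) ∩ S) →
                 Separates S (f ∘ suc) → Separates S f
separates-cons new old zero    zero    0≢0 = contradiction refl 0≢0
separates-cons new old zero    (suc j) _   = new j
separates-cons new old (suc i) zero    _   = new i ∘ sym
separates-cons new old (suc i) (suc j) i≢j = old i j (i≢j ∘ cong suc)

bondy : ∀ m {n} (f : Fin (suc m) → Subset n) →
        (∀ i j → i ≢ j → f i ≢ f j) → ∃ λ S → Separates S f × ∣ S ∣ ≤ m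
bondy zero {n} f distinct =
  -- A single subset leaves no pair to separate.
  ⊥ , (λ { zero zero 0≢0 → contradiction refl 0≢0 }) , ≤-reflexive (∣⊥∣≡0 n)
bondy (suc m) f distinct
  with S , sepS , ∣S∣≤m ← bondy m (f ∘ suc)
         (λ i j i≢j → distinct (suc i) (suc j) (i≢j ∘ Fin.suc-injective))
  with Fin.any? (λ i → (f zero ∩ S) ≟ₛ (f (suc i) ∩ S))
... | no ∄i = S , separates-cons (λ j eq → ∄i (j , eq)) sepS , m≤n⇒m≤1+n ∣S∣≤m
... | yes (i , f₀≡fᵢ)
  with x , differ ← ≢⇒∃-∩⁅x⁆-≢ (distinct zero (suc i) λ ()) =
  S ∪ ⁅ x ⁆ ,
  separates-cons new (λ j k j≢k → sepS j k j≢k ∘ ∩∪-≡⇒∩ˡ-≡ S ⁅ x ⁆) ,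
  ≤-trans (∣p∪⁅x⁆∣≤1+∣p∣ S x) (s≤s ∣S∣≤m)
  where
  new : ∀ j → f zero ∩ (S ∪ ⁅ x ⁆) ≢ f (suc j) ∩ (S ∪ ⁅ x ⁆)
  new j eq with i Fin.≟ j
  ... | yes refl = differ (∩∪-≡⇒∩ʳ-≡ S ⁅ x ⁆ eq)
  -- On `S`, `f zero` already agrees with `f (suc i)`; agreeing with `f (suc j)` too would make
  -- those two agree there, against `sepS`.
  ... | no i≢j   =
    sepS i j i≢j (trans (sym f₀≡fᵢ) (∩∪-≡⇒∩ˡ-≡ S ⁅ x ⁆ eq))

-- Vertices of different colors are distinct.
separating⇒redBlueSeparating : ∀ {n} (G : Graph n) c {S} →
                               Separating G S → RedBlueSeparating G c S
separating⇒redBlueSeparating G c sepS r b cr cb = sepS r b r≢b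
  where
  r≢b : r ≢ b
  r≢b refl with () ← trans (sym cr) cb

module _ {n} (G : Graph n) (tf : TwinFree G) where

  sep≤∣S∣ : ∀ {S} → Separating G S → sep G tf ≤ ∣ S ∣
  sep≤∣S∣ {S} sepS = proj₂ (proj₂ (sep-exists G tf)) (S , sepS , refl)

  sepRB≤sep : ∀ c → sepRB G tf c ≤ sep G tf
  sepRB≤sep c with S , sepS , ∣S∣≡sep ← proj₁ (proj₂ (sep-exists G tf)) =
    proj₂ (proj₂ (sepRB-exists G tf c))
      (S , separating⇒redBlueSeparating G c sepS , ∣S∣≡sep)

  max-sepRB≤sep : max-sepRB G tf ≤ sep G tf
  -- The maximum is attained at some coloring `c`, so the bound for a single coloring suffices.
  max-sepRB≤sep with c , eq ← proj₁ (proj₂ (max-sepRB-exists G tf)) =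
    subst (_≤ sep G tf) eq (sepRB≤sep c)

corollary13 : ∀ (n : ℕ) → .{{_ : NonZero n}} → (G : Graph n) (tf : TwinFree G) →
    (max-sepRB G tf ≤ sep G tf) × (sep G tf ≤ n ∸ 1)
corollary13 (suc m) G tf = max-sepRB≤sep G tf , sep≤m
  where
  sep≤m : sep G tf ≤ m
  -- Twin-freeness says exactly that the `suc m` closed neighborhoods are pairwise distinct, and
  -- separating them is separating the vertices.
  sep≤m with S , sepS , ∣S∣≤m ← bondy m (Graph.N[_] G) tf =
    ≤-trans (sep≤∣S∣ G tf sepS) ∣S∣≤m
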